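{- There exists a constant $\gamma>0$ such that for every constant $0<\eta\le 0.1$, for every connected $P_6$-free graph $G$ on at least two vertices, for every threshold $\tau$ with $(1-2\eta)|V(G)|\le\tau\le(1-\eta)|V(G)|$, for every inclusion-wise minimal $(\eta,\tau)$-nuke $X$ in $G$, and for every probability measure $\mu$ on $X$, there exists a vertex $v\in V(G)$ with $\mu(N(v))\ge\gamma$.
   Context: Graphs are finite, simple, undirected; $P_6$-free means no induced path on $6$ vertices. $N(v)$ is the open neighbourhood and $\mu(N(v))$ means $\mu(N(v)\cap X)$. For $0<\eta\le 0.1$ and $\tau\ge 0$, a set $X\subseteq V(G)$ is an $(\eta,\tau)$-nuke in $G$ if: $(1-2\eta)|V(G)|\le\tau\le(1-\eta)|V(G)|$; $|X|\le\eta|V(G)|$; and every connected component $C$ of $G-X$ satisfies $|C|+|X|\le\tau$. Inclusion-wise minimal means no proper subset of $X$ is an $(\eta,\tau)$-nuke in $G$.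
   Formalization: The constant η, the threshold τ and the values of the probability measure μ are taken to be rational numbers instead of real numbers (the constant γ obtained is rational too). -}

module Defs where

open import Data.Nat using (ℕ; zero; suc)
open import Data.Bool using (Bool; true; false; if_then_else_)
open import Data.Fin using (Fin; toℕ) renaming (zero to fzero; suc to fsuc)
open import Data.Fin.Subset using (Subset; _∈_; _∉_; _⊂_; ∣_∣)
open import Data.Vec using (tabulate; lookup)
open import Data.Integer using (+_)
open import Data.Rational using (ℚ; _/_; 0ℚ; 1ℚ; _+_; _-_; _*_; _≤_; _<_)
open import Data.Product using (Σ; ∃; _×_; _,_)
open import Data.Sum using (_⊎_)
open import Function using (_∘_)
open import Function.Bundles using (_⇔_)
open import Function.Definitions using (Injective)
open import Relation.Binary.PropositionalEquality using (_≡_)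
open import Relation.Nullary using (¬_)

record Graph (n : ℕ) : Set where
  field
    adj    : Fin n → Fin n → Bool
    sym    : ∀ u v → adj u v ≡ adj v u
    irrefl : ∀ v → adj v v ≡ false
open Graph public

ℕtoℚ : ℕ → ℚ
ℕtoℚ m = (+ m) / 1

data WalkIn {n : ℕ} (G : Graph n) (S : Subset n) : Fin n → Fin n → Set where
  here : ∀ {u} → u ∈ S → WalkIn G S u u
  step : ∀ {u w v} → u ∈ S → adj G u w ≡ true → WalkIn G S w v → WalkIn G S u v

Connected : ∀ {n} → Graph n → Set
Connected {n} G = ∀ (u v : Fin n) → WalkIn G (tabulate (λ _ → true)) u v

Consecutive : ∀ {k} → Fin k → Fin k → Set
Consecutive i j = toℕ j ≡ suc (toℕ i) ⊎ toℕ i ≡ suc (toℕ j)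

InducedP6 : ∀ {n} → Graph n → (Fin 6 → Fin n) → Set
InducedP6 G f = Injective _≡_ _≡_ f × (∀ i j → (adj G (f i) (f j) ≡ true) ⇔ Consecutive i j)

P6Free : ∀ {n} → Graph n → Set
P6Free {n} G = ¬ (Σ (Fin 6 → Fin n) λ f → InducedP6 G f)

IsComponentOfMinus : ∀ {n} → Graph n → Subset n → Subset n → Set
IsComponentOfMinus {n} G X C =
  (∃ λ u → u ∈ C)
  × (∀ u → u ∈ C → u ∉ X)
  × (∀ u v → u ∈ C → v ∈ C → WalkIn G C u v)
  × (∀ u w → u ∈ C → adj G u w ≡ true → w ∉ X → w ∈ C)

IsNuke : ∀ {n} → Graph n → ℚ → ℚ → Subset n → Set
IsNuke {n} G η τ X =
  (0ℚ < η) × (η ≤ (+ 1) / 10) × (0ℚ ≤ τ)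
  × ((1ℚ - ((+ 2) / 1) * η) * ℕtoℚ n ≤ τ) × (τ ≤ (1ℚ - η) * ℕtoℚ n)
  × (ℕtoℚ ∣ X ∣ ≤ η * ℕtoℚ n)
  × (∀ C → IsComponentOfMinus G X C → ℕtoℚ (∣ C ∣ Data.Nat.+ ∣ X ∣) ≤ τ)

IsMinimalNuke : ∀ {n} → Graph n → ℚ → ℚ → Subset n → Set
IsMinimalNuke G η τ X = IsNuke G η τ X × (∀ Y → Y ⊂ X → ¬ IsNuke G η τ Y)

sumFin : ∀ {n} → (Fin n → ℚ) → ℚ
sumFin {zero}  f = 0ℚ
sumFin {suc n} f = f fzero + sumFin (f ∘ fsuc)

measure : ∀ {n} → (Fin n → ℚ) → Subset n → ℚ
measure μ S = sumFin (λ u → if lookup S u then μ u else 0ℚ)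

IsProbOn : ∀ {n} → Subset n → (Fin n → ℚ) → Set
IsProbOn {n} X μ = (∀ u → 0ℚ ≤ μ u) × (∀ u → u ∉ X → μ u ≡ 0ℚ) × (measure μ X ≡ 1ℚ)

N : ∀ {n} → Graph n → Fin n → Subset n
N G v = tabulate (adj G v)

oneTenth : ℚ
oneTenth = (+ 1) / 10

{-# OPTIONS --safe #-}
module Submission where

-- By minimality, putting x ∈ X back merges components of G - X into a component that is too large.
-- Hence x has neighbours in at least two components, and the components adjacent to x cover more than
-- (1 - 2η)n - ηn ≥ 7n/10 vertices; averaging over the vertices v of G gives a component D, that of some v,
-- adjacent to all of X up to measure 3/10. Fix for each such x a neighbour b(x) in D and a neighbour a(x)
-- in another component, and for each pair x, y a common neighbour d(x, y) in D if there is one.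
--
-- If every neighbourhood had small measure, then for independent samples x, y, z, with positive probability,
-- z would avoid the neighbourhoods of all vertices chosen for x and y, and similarly for the
-- other two. Such a triple yields an induced P₆:
--   * a(x) ~ a(y) and a(x) ~ a(z): in b(x) x a(x) a(z) z b(z) or in y a(y) a(x) x b(x) b(z);
--   * otherwise, say, a(x) ≁ a(y) and a(y) ≁ a(z): either a shortest path through D with its two pendants
--     is too long, or d = d(x, y) and d′ = d(y, z) exist and one of a(x) x d y d′ z, a(x) x d d′ z a(z)
--     and a(y) y d x a(x) a(z) is induced.

open import Defs
open import Data.Nat using (ℕ; _≤_)
open import Data.Fin using (Fin)
open import Data.Fin.Subset using (Subset; _∩_)
open import Data.Rational using (ℚ; 0ℚ; 1ℚ; _<_; _*_; _-_) renaming (_≤_ to _≤ℚ_)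
open import Data.Product using (Σ; ∃; _×_)

open import Data.Bool using (Bool; true; false; not; if_then_else_; _∧_; _∨_)
import Data.Bool.Properties as Bool
open import Data.Empty using (⊥; ⊥-elim)
open import Data.Fin using (zero; suc; toℕ)
open import Data.Fin.Properties using (all?; any?; _≟_)
open import Data.Fin.Subset using (_∈_; _∉_; _⊆_; _⊂_; _⊃_; _∪_; ⋃; ⁅_⁆; ∣_∣; inside; outside) renaming (_-_ to _∖_)
open import Data.Fin.Subset.Induction using (Acc; acc; ⊃-wellFounded)
open import Data.Fin.Subset.Properties
import Data.Integer as ℤ
import Data.Integer.Properties as ℤ
open import Data.List using (List; []; _∷_; length; map)
import Data.List.Relation.Unary.All as ListAll
open ListAll using ([]; _∷_)
open import Data.Nat as ℕ using (zero; suc; z≤n)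
import Data.Nat.Properties as ℕ
open import Data.Product using (∃₂; _,_; proj₁; proj₂)
open import Data.Rational as ℚ using (_+_)
import Data.Rational.Properties as ℚ
open import Data.Rational.Solver using (module +-*-Solver)
import Data.Rational.Unnormalised as ℚᵘ
import Data.Rational.Unnormalised.Properties as ℚᵘ
open import Data.Sum using (_⊎_; inj₁; inj₂)
open import Data.Unit using (⊤; tt)
open import Data.Vec using (Vec; []; _∷_; lookup; tabulate; here; there)
open import Data.Vec.Properties using ([]=⇒lookup; lookup⇒[]=; lookup-replicate; lookup-zipWith; lookup∘tabulate)
open import Data.Vec.Relation.Unary.All using (All; []; _∷_)
import Data.Vec.Relation.Unary.All.Properties as VecAll
open import Function.Bundles using (mk⇔)
open import Relation.Binary.PropositionalEquality as ≡ using (_≡_; refl; trans; cong; cong₂; subst)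
open import Relation.Nullary using (¬_; Dec; yes; no; contradiction)
open import Relation.Nullary.Decidable
  using (from-yes; toWitness; ¬?; decidable-stable; _→-dec_; _⊎-dec_; _×-dec_)

-- Expectations over a finite probability space

ℚ<⇒≱ : ∀ {p q} → p < q → ¬ q ≤ℚ p
ℚ<⇒≱ p<q q≤p = ℚ.<-irrefl refl (ℚ.<-≤-trans p<q q≤p)

-- The quotient `_/_` is normalised by a gcd; in the unnormalised rationals a plain integer
-- inequality remains.
ℕtoℚ-mono : ∀ {k l} → k ≤ l → ℕtoℚ k ≤ℚ ℕtoℚ l
ℕtoℚ-mono {k} {l} k≤l = ℚ.toℚᵘ-cancel-≤ (begin
  ℚ.toℚᵘ (ℕtoℚ k)          ≃⟨ ℚ.toℚᵘ-fromℚᵘ (ℚᵘ.mkℚᵘ (ℤ.+ k) 0) ⟩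
  ℚᵘ.mkℚᵘ (ℤ.+ k) 0        ≤⟨ ℚᵘ.*≤* (ℤ.*-monoʳ-≤-nonNeg (ℤ.+ 1) (ℤ.+≤+ k≤l)) ⟩
  ℚᵘ.mkℚᵘ (ℤ.+ l) 0        ≃⟨ ℚ.toℚᵘ-fromℚᵘ (ℚᵘ.mkℚᵘ (ℤ.+ l) 0) ⟨
  ℚ.toℚᵘ (ℕtoℚ l)          ∎)
  where open ℚᵘ.≤-Reasoning

ℕtoℚ-+ : ∀ k l → ℕtoℚ (k ℕ.+ l) ≡ ℕtoℚ k + ℕtoℚ l
ℕtoℚ-+ k l = ℚ.toℚᵘ-injective (begin
  ℚ.toℚᵘ (ℕtoℚ (k ℕ.+ l))                 ≈⟨ ℚ.toℚᵘ-fromℚᵘ (ℚᵘ.mkℚᵘ (ℤ.+ (k ℕ.+ l)) 0) ⟩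
  ℚᵘ.mkℚᵘ (ℤ.+ (k ℕ.+ l)) 0
    ≈⟨ ℚᵘ.*≡* (cong (λ i → i ℤ.* (ℤ.+ 1))
         (cong₂ ℤ._+_ (≡.sym (ℤ.*-identityʳ (ℤ.+ k))) (≡.sym (ℤ.*-identityʳ (ℤ.+ l))))) ⟩
  ℚᵘ.mkℚᵘ (ℤ.+ k) 0 ℚᵘ.+ ℚᵘ.mkℚᵘ (ℤ.+ l) 0
    ≈⟨ ℚᵘ.+-cong (ℚ.toℚᵘ-fromℚᵘ (ℚᵘ.mkℚᵘ (ℤ.+ k) 0)) (ℚ.toℚᵘ-fromℚᵘ (ℚᵘ.mkℚᵘ (ℤ.+ l) 0)) ⟨
  ℚ.toℚᵘ (ℕtoℚ k) ℚᵘ.+ ℚ.toℚᵘ (ℕtoℚ l)    ≈⟨ ℚ.toℚᵘ-homo-+ (ℕtoℚ k) (ℕtoℚ l) ⟨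
  ℚ.toℚᵘ (ℕtoℚ k + ℕtoℚ l)                ∎)
  where open import Relation.Binary.Reasoning.Setoid ℚᵘ.≃-setoid

*-monoˡ-≤ : ∀ {r p q} → 0ℚ ≤ℚ r → p ≤ℚ q → r * p ≤ℚ r * q
*-monoˡ-≤ {r} r≥0 = ℚ.*-monoˡ-≤-nonNeg r {{ℚ.nonNegative r≥0}}

p≤p+q : ∀ {p q} → 0ℚ ≤ℚ q → p ≤ℚ p + q
p≤p+q {p} {q} q≥0 = subst (_≤ℚ p + q) (ℚ.+-identityʳ p) (ℚ.+-monoʳ-≤ p q≥0)

p≤q+p : ∀ {p q} → 0ℚ ≤ℚ q → p ≤ℚ q + p
p≤q+p {p} {q} q≥0 = subst (_≤ℚ q + p) (ℚ.+-identityˡ p) (ℚ.+-monoˡ-≤ p q≥0)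

+-interchange : ∀ a b c d → (a + b) + (c + d) ≡ (a + c) + (b + d)
+-interchange = solve 4 (λ a b c d → (a :+ b) :+ (c :+ d) := (a :+ c) :+ (b :+ d)) refl
  where open +-*-Solver

sumFin-cong : ∀ {n} {f g : Fin n → ℚ} → (∀ u → f u ≡ g u) → sumFin f ≡ sumFin g
sumFin-cong {zero}  eq = refl
sumFin-cong {suc n} eq = cong₂ _+_ (eq zero) (sumFin-cong λ u → eq (suc u))

sumFin-mono : ∀ {n} {f g : Fin n → ℚ} → (∀ u → f u ≤ℚ g u) → sumFin f ≤ℚ sumFin g
sumFin-mono {zero}  le = ℚ.≤-refl
sumFin-mono {suc n} le = ℚ.+-mono-≤ (le zero) (sumFin-mono λ u → le (suc u))

sumFin-mono-< : ∀ {n} {f g : Fin (suc n) → ℚ} → (∀ u → f u < g u) → sumFin f < sumFin g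
sumFin-mono-< lt = ℚ.+-mono-<-≤ (lt zero) (sumFin-mono λ u → ℚ.<⇒≤ (lt (suc u)))

sumFin-+ : ∀ {n} (f g : Fin n → ℚ) → sumFin (λ u → f u + g u) ≡ sumFin f + sumFin g
sumFin-+ {zero}  f g = refl
sumFin-+ {suc n} f g = trans (cong (f zero + g zero +_) (sumFin-+ (λ u → f (suc u)) (λ u → g (suc u))))
  (+-interchange (f zero) (g zero) _ _)

sumFin-*ˡ : ∀ {n} c (f : Fin n → ℚ) → sumFin (λ u → c * f u) ≡ c * sumFin f
sumFin-*ˡ {zero}  c f = ≡.sym (ℚ.*-zeroʳ c)
sumFin-*ˡ {suc n} c f = trans (cong (c * f zero +_) (sumFin-*ˡ c (λ u → f (suc u))))
  (≡.sym (ℚ.*-distribˡ-+ c (f zero) _))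

sumFin-const : ∀ n c → sumFin {n} (λ _ → c) ≡ ℕtoℚ n * c
sumFin-const zero    c = ≡.sym (ℚ.*-zeroˡ c)
sumFin-const (suc n) c = begin
  c + sumFin {n} (λ _ → c)  ≡⟨ cong (c +_) (sumFin-const n c) ⟩
  c + ℕtoℚ n * c            ≡⟨ cong (_+ ℕtoℚ n * c) (ℚ.*-identityˡ c) ⟨
  1ℚ * c + ℕtoℚ n * c       ≡⟨ ℚ.*-distribʳ-+ c 1ℚ (ℕtoℚ n) ⟨
  (1ℚ + ℕtoℚ n) * c         ≡⟨ cong (_* c) (ℕtoℚ-+ 1 n) ⟨
  ℕtoℚ (suc n) * c          ∎
  where open ≡.≡-Reasoning

sumFin-swap : ∀ {m n} (f : Fin m → Fin n → ℚ) →
              sumFin (λ u → sumFin (f u)) ≡ sumFin (λ v → sumFin (λ u → f u v))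
sumFin-swap {zero}  {n} f = ≡.sym (trans (sumFin-const n 0ℚ) (ℚ.*-zeroʳ (ℕtoℚ n)))
sumFin-swap {suc m} {n} f = trans (cong (sumFin (f zero) +_) (sumFin-swap (λ u → f (suc u))))
  (≡.sym (sumFin-+ (f zero) (λ v → sumFin (λ u → f (suc u) v))))

-- If every value exceeded `c`, the sum would exceed `n * c`, strictly since there is at least one
-- summand.
average-≤ : ∀ {n} c (f : Fin n → ℚ) → 1 ≤ n → sumFin f ≤ℚ ℕtoℚ n * c → ∃ λ v → f v ≤ℚ c
average-≤ {suc n} c f _ le = decidable-stable (any? (λ v → f v ℚ.≤? c)) λ none →
  ℚ<⇒≱ (sumFin-mono-< (λ v → ℚ.≰⇒> (λ le → none (v , le))))
        (subst (sumFin f ≤ℚ_) (≡.sym (sumFin-const (suc n) c)) le)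

indicator : ∀ {n} → Subset n → Fin n → ℚ
indicator S u = if lookup S u then 1ℚ else 0ℚ

∈⇒indicator : ∀ {n} {S : Subset n} {u} → u ∈ S → indicator S u ≡ 1ℚ
∈⇒indicator u∈S rewrite []=⇒lookup u∈S = refl

indicator≥0 : ∀ {n} (S : Subset n) u → 0ℚ ≤ℚ indicator S u
indicator≥0 S u with lookup S u
... | true  = ℚ.nonNegative⁻¹ 1ℚ
... | false = ℚ.≤-refl

∣∣≡sumFin-indicator : ∀ {n} (S : Subset n) → ℕtoℚ ∣ S ∣ ≡ sumFin (indicator S)
∣∣≡sumFin-indicator []            = refl
∣∣≡sumFin-indicator (outside ∷ S) = trans (∣∣≡sumFin-indicator S) (≡.sym (ℚ.+-identityˡ _))
∣∣≡sumFin-indicator (inside ∷ S)  = trans (ℕtoℚ-+ 1 ∣ S ∣) (cong (1ℚ +_) (∣∣≡sumFin-indicator S))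

module _ {n : ℕ} (μ : Fin n → ℚ) where

  𝔼 : (Fin n → ℚ) → ℚ
  𝔼 f = sumFin (λ u → μ u * f u)

  measure≡𝔼 : ∀ S → measure μ S ≡ 𝔼 (indicator S)
  measure≡𝔼 S = sumFin-cong pointwise
    where
    pointwise : ∀ u → (if lookup S u then μ u else 0ℚ) ≡ μ u * indicator S u
    pointwise u with lookup S u
    ... | true  = ≡.sym (ℚ.*-identityʳ (μ u))
    ... | false = ≡.sym (ℚ.*-zeroʳ (μ u))

  𝔼-+ : ∀ f g → 𝔼 (λ u → f u + g u) ≡ 𝔼 f + 𝔼 g
  𝔼-+ f g = trans (sumFin-cong (λ u → ℚ.*-distribˡ-+ (μ u) (f u) (g u)))
    (sumFin-+ (λ u → μ u * f u) (λ u → μ u * g u))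

  sumFin-𝔼 : ∀ {m} (f : Fin m → Fin n → ℚ) → sumFin (λ v → 𝔼 (f v)) ≡ 𝔼 (λ u → sumFin (λ v → f v u))
  sumFin-𝔼 f = trans (sumFin-swap (λ v u → μ u * f v u)) (sumFin-cong (λ u → sumFin-*ˡ (μ u) (λ v → f v u)))

  𝔼-swap : ∀ (f : Fin n → Fin n → ℚ) → 𝔼 (λ u → 𝔼 (f u)) ≡ 𝔼 (λ v → 𝔼 (λ u → f u v))
  𝔼-swap f = begin
    sumFin (λ u → μ u * 𝔼 (f u))
      ≡⟨ sumFin-cong (λ u → sumFin-*ˡ (μ u) (λ v → μ v * f u v)) ⟨
    sumFin (λ u → sumFin (λ v → μ u * (μ v * f u v)))
      ≡⟨ sumFin-cong (λ u → sumFin-cong (λ v → exchange (μ u) (μ v) (f u v))) ⟩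
    sumFin (λ u → 𝔼 (λ v → μ u * f u v))
      ≡⟨ sumFin-𝔼 (λ u v → μ u * f u v) ⟩
    𝔼 (λ v → 𝔼 (λ u → f u v)) ∎
    where
    open ≡.≡-Reasoning
    exchange : ∀ a b c → a * (b * c) ≡ b * (a * c)
    exchange = solve 3 (λ a b c → a :* (b :* c) := b :* (a :* c)) refl
      where open +-*-Solver

  module _ (μ≥0 : ∀ u → 0ℚ ≤ℚ μ u) where

    𝔼-mono : ∀ {f g} → (∀ u → f u ≤ℚ g u) → 𝔼 f ≤ℚ 𝔼 g
    𝔼-mono le = sumFin-mono (λ u → *-monoˡ-≤ (μ≥0 u) (le u))

    measure-∪ : ∀ S T → measure μ (S ∪ T) ≤ℚ measure μ S + measure μ T
    measure-∪ S T = subst (measure μ (S ∪ T) ≤ℚ_)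
      (sumFin-+ (λ u → if lookup S u then μ u else 0ℚ) (λ u → if lookup T u then μ u else 0ℚ))
      (sumFin-mono pointwise)
      where
      pointwise : ∀ u → (if lookup (S ∪ T) u then μ u else 0ℚ)
                      ≤ℚ (if lookup S u then μ u else 0ℚ) + (if lookup T u then μ u else 0ℚ)
      pointwise u rewrite lookup-zipWith _∨_ u S T with lookup S u | lookup T u
      ... | true  | true  = p≤p+q (μ≥0 u)
      ... | true  | false = ℚ.≤-reflexive (≡.sym (ℚ.+-identityʳ (μ u)))
      ... | false | true  = ℚ.≤-reflexive (≡.sym (ℚ.+-identityˡ (μ u)))
      ... | false | false = ℚ.≤-refl

    measure-⋃ : ∀ {A : Set} {c} (S : A → Subset n) → (∀ a → measure μ (S a) ≤ℚ c) →
                ∀ as → measure μ (⋃ (map S as)) ≤ℚ ℕtoℚ (length as) * c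
    measure-⋃ {c = c} S le [] = ℚ.≤-reflexive (trans empty (≡.sym (ℚ.*-zeroˡ c)))
      where
      empty : measure μ (⋃ []) ≡ 0ℚ
      empty = trans (sumFin-cong (λ u → cong (λ b → if b then μ u else 0ℚ) (lookup-replicate u outside)))
                    (trans (sumFin-const n 0ℚ) (ℚ.*-zeroʳ (ℕtoℚ n)))
    measure-⋃ {c = c} S le (a ∷ as) = begin
      measure μ (S a ∪ ⋃ (map S as))              ≤⟨ measure-∪ (S a) (⋃ (map S as)) ⟩
      measure μ (S a) + measure μ (⋃ (map S as))  ≤⟨ ℚ.+-mono-≤ (le a) (measure-⋃ S le as) ⟩
      c + ℕtoℚ (length as) * c                    ≡⟨ cong (_+ ℕtoℚ (length as) * c) (ℚ.*-identityˡ c) ⟨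
      1ℚ * c + ℕtoℚ (length as) * c               ≡⟨ ℚ.*-distribʳ-+ c 1ℚ (ℕtoℚ (length as)) ⟨
      (1ℚ + ℕtoℚ (length as)) * c                 ≡⟨ cong (_* c) (ℕtoℚ-+ 1 (length as)) ⟨
      ℕtoℚ (suc (length as)) * c                  ∎
      where open ℚ.≤-Reasoning

    module _ (total : sumFin μ ≡ 1ℚ) where

      𝔼-const : ∀ c → 𝔼 (λ _ → c) ≡ c
      𝔼-const c = begin
        sumFin (λ u → μ u * c)  ≡⟨ sumFin-cong (λ u → ℚ.*-comm (μ u) c) ⟩
        sumFin (λ u → c * μ u)  ≡⟨ sumFin-*ˡ c μ ⟩
        c * sumFin μ            ≡⟨ cong (c *_) total ⟩
        c * 1ℚ                  ≡⟨ ℚ.*-identityʳ c ⟩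
        c                       ∎
        where open ≡.≡-Reasoning

      𝔼-≤ : ∀ {f c} → (∀ u → f u ≤ℚ c) → 𝔼 f ≤ℚ c
      𝔼-≤ {f} {c} le = subst (𝔼 f ≤ℚ_) (𝔼-const c) (𝔼-mono le)

      ≤-𝔼 : ∀ {f c} → (∀ u → c ≤ℚ f u) → c ≤ℚ 𝔼 f
      ≤-𝔼 {f} {c} le = subst (_≤ℚ 𝔼 f) (𝔼-const c) (𝔼-mono le)

      -- The union bound over three independent samples x, y, z.
      triple-bound : ∀ {c} (B : Fin n → Fin n → Subset n) → (∀ x y → measure μ (B x y) ≤ℚ c) →
                     (∀ x y z → z ∈ B x y ⊎ x ∈ B y z ⊎ y ∈ B z x) → 1ℚ ≤ℚ c + (c + c)
      triple-bound {c} B B≤c cover = begin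
        1ℚ
          ≤⟨ ≤-𝔼 (λ x → ≤-𝔼 (λ y → ≤-𝔼 (λ z → covered x y z))) ⟩
        𝔼³ (λ x y z → I₁ x y z + (I₂ x y z + I₃ x y z))
          ≡⟨ split₃ ⟩
        𝔼³ I₁ + (𝔼³ I₂ + 𝔼³ I₃)
          ≤⟨ ℚ.+-mono-≤ first≤c (ℚ.+-mono-≤ second≤c third≤c) ⟩
        c + (c + c) ∎
        where
        open ℚ.≤-Reasoning
        𝔼³ : (Fin n → Fin n → Fin n → ℚ) → ℚ
        𝔼³ f = 𝔼 (λ x → 𝔼 (λ y → 𝔼 (f x y)))
        I₁ I₂ I₃ : Fin n → Fin n → Fin n → ℚ
        I₁ x y z = indicator (B x y) z
        I₂ x y z = indicator (B y z) x
        I₃ x y z = indicator (B z x) y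
        covered : ∀ x y z → 1ℚ ≤ℚ I₁ x y z + (I₂ x y z + I₃ x y z)
        covered x y z with cover x y z
        ... | inj₁ h rewrite ∈⇒indicator h =
          p≤p+q (ℚ.+-mono-≤ (indicator≥0 (B y z) x) (indicator≥0 (B z x) y))
        ... | inj₂ (inj₁ h) rewrite ∈⇒indicator h =
          ℚ.≤-trans (p≤p+q (indicator≥0 (B z x) y)) (p≤q+p (indicator≥0 (B x y) z))
        ... | inj₂ (inj₂ h) rewrite ∈⇒indicator h =
          ℚ.≤-trans (p≤q+p (indicator≥0 (B y z) x)) (p≤q+p (indicator≥0 (B x y) z))
        𝔼-cong : ∀ {f g} → (∀ u → f u ≡ g u) → 𝔼 f ≡ 𝔼 g
        𝔼-cong eq = sumFin-cong (λ u → cong (μ u *_) (eq u))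
        𝔼³-+ : ∀ (f g : Fin n → Fin n → Fin n → ℚ) →
               𝔼³ (λ x y z → f x y z + g x y z)
               ≡ 𝔼³ f + 𝔼³ g
        𝔼³-+ f g = trans
          (𝔼-cong (λ x → trans (𝔼-cong (λ y → 𝔼-+ (f x y) (g x y))) (𝔼-+ (λ y → 𝔼 (f x y)) (λ y → 𝔼 (g x y)))))
          (𝔼-+ (λ x → 𝔼 (λ y → 𝔼 (f x y))) (λ x → 𝔼 (λ y → 𝔼 (g x y))))
        split₃ : 𝔼³ (λ x y z → I₁ x y z + (I₂ x y z + I₃ x y z))
               ≡ 𝔼³ I₁ + (𝔼³ I₂ + 𝔼³ I₃)
        split₃ = trans (𝔼³-+ I₁ (λ x y z → I₂ x y z + I₃ x y z))
                       (cong (𝔼³ I₁ +_) (𝔼³-+ I₂ I₃))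
        B≤c′ : ∀ x y → 𝔼 (indicator (B x y)) ≤ℚ c
        B≤c′ x y = subst (_≤ℚ c) (measure≡𝔼 (B x y)) (B≤c x y)
        first≤c : 𝔼³ I₁ ≤ℚ c
        first≤c = 𝔼-≤ (λ x → 𝔼-≤ (λ y → B≤c′ x y))
        -- Two swaps make the sample that is tested for membership the innermost one, where its
        -- expectation is a measure.
        second≤c : 𝔼³ I₂ ≤ℚ c
        second≤c = subst (_≤ℚ c)
          (≡.sym (trans (𝔼-swap (λ x y → 𝔼 (I₂ x y))) (𝔼-cong (λ y → 𝔼-swap (λ x z → I₂ x y z)))))
          (𝔼-≤ (λ y → 𝔼-≤ (λ z → B≤c′ y z)))
        third≤c : 𝔼³ I₃ ≤ℚ c
        third≤c = subst (_≤ℚ c)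
          (≡.sym (trans (𝔼-cong (λ x → 𝔼-swap (I₃ x))) (𝔼-swap (λ x z → 𝔼 (λ y → I₃ x y z)))))
          (𝔼-≤ (λ z → 𝔼-≤ (λ x → B≤c′ z x)))

-- Induced paths on six vertices

isZero : ∀ {k} → Fin k → Bool
isZero zero    = true
isZero (suc _) = false

-- Boolean and structurally recursive: it peels off first vertices in step with `Chordless`, and
-- claims about `Fin 6` can be settled by evaluation.
consecutive : ∀ {k l} → Fin k → Fin l → Bool
consecutive zero    zero    = false
consecutive zero    (suc j) = isZero j
consecutive (suc i) zero    = isZero i
consecutive (suc i) (suc j) = consecutive i j

-- Checked by enumeration. On three vertices it would fail: both ends of such a path have the same
-- neighbour.
consecutive-injective : ∀ (i j : Fin 6) → (∀ k → consecutive {l = 6} i k ≡ consecutive j k) → i ≡ j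
consecutive-injective = from-yes (all? {n = 6} λ i → all? {n = 6} λ j →
  all? {n = 6} (λ k → consecutive {l = 6} i k Bool.≟ consecutive j k) →-dec (i ≟ j))

consecutive-sound : ∀ (i j : Fin 6) → consecutive i j ≡ true → Consecutive i j
consecutive-sound = from-yes (all? {n = 6} λ i → all? {n = 6} λ j → (consecutive i j Bool.≟ true) →-dec
  ((toℕ j ℕ.≟ suc (toℕ i)) ⊎-dec (toℕ i ℕ.≟ suc (toℕ j))))

consecutive-complete : ∀ (i j : Fin 6) → Consecutive i j → consecutive i j ≡ true
consecutive-complete = from-yes (all? {n = 6} λ i → all? {n = 6} λ j →
  ((toℕ j ℕ.≟ suc (toℕ i)) ⊎-dec (toℕ i ℕ.≟ suc (toℕ j))) →-dec (consecutive i j Bool.≟ true))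

module _ {n : ℕ} (G : Graph n) where

  infix 4 _~_ _≁_

  _~_ _≁_ : Fin n → Fin n → Set
  u ~ v = adj G u v ≡ true
  u ≁ v = adj G u v ≡ false

  ~-sym : ∀ {u v} → u ~ v → v ~ u
  ~-sym {u} {v} = trans (sym G v u)

  ≁-sym : ∀ {u v} → u ≁ v → v ≁ u
  ≁-sym {u} {v} = trans (sym G v u)

  ~?≁ : ∀ u v → u ~ v ⊎ u ≁ v
  ~?≁ u v with adj G u v
  ... | true  = inj₁ refl
  ... | false = inj₂ refl

  ~⇒¬≁ : ∀ {u v} → u ~ v → u ≁ v → ⊥
  ~⇒¬≁ e f with () ← trans (≡.sym e) f

  -- Each pair appears once, so a path on six vertices takes five edges and ten non-edges; symmetry
  -- supplies the reversed pairs.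
  Chordless : ∀ {k} → Vec (Fin n) k → Set
  Chordless []           = ⊤
  Chordless (u ∷ [])     = ⊤
  Chordless (u ∷ w ∷ us) = u ~ w × All (u ≁_) us × Chordless (w ∷ us)

  chordless⇒adj : ∀ {k} {us : Vec (Fin n) k} → Chordless us →
                  ∀ i j → adj G (lookup us i) (lookup us j) ≡ consecutive i j
  chordless⇒adj {us = u ∷ _}     _           zero          zero          = irrefl G u
  chordless⇒adj {us = _ ∷ _ ∷ _} (e , _ , _) zero          (suc zero)    = e
  chordless⇒adj {us = _ ∷ _ ∷ _} (_ , f , _) zero          (suc (suc j)) = VecAll.lookup⁺ f j
  chordless⇒adj {us = _ ∷ _ ∷ _} (e , _ , _) (suc zero)    zero          = ~-sym e
  chordless⇒adj {us = _ ∷ _ ∷ _} (_ , f , _) (suc (suc i)) zero          = ≁-sym (VecAll.lookup⁺ f i)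
  chordless⇒adj {us = _ ∷ _ ∷ _} (_ , _ , c) (suc i)       (suc j)       = chordless⇒adj c i j

  -- The six vertices are automatically distinct, as no two vertices of P₆ have the same neighbours.
  chordless⇒P₆ : (us : Vec (Fin n) 6) → Chordless us → InducedP6 G (lookup us)
  chordless⇒P₆ us c =
    (λ {i} {j} eq → consecutive-injective i j λ k →
      trans (≡.sym (chordless⇒adj c i k))
        (trans (cong (λ u → adj G u (lookup us k)) eq) (chordless⇒adj c j k))) ,
    λ i j → mk⇔ (λ e → consecutive-sound i j (trans (≡.sym (chordless⇒adj c i j)) e))
                (λ e → trans (chordless⇒adj c i j) (consecutive-complete i j e))

  -- Chordless paths through a set `D`

  module _ (D : Subset n) where

    -- All vertices but the last one, y, lie in D.
    data ChordlessTo (y : Fin n) : List (Fin n) → Set where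
      end  : ChordlessTo y (y ∷ [])
      cons : ∀ {u w us} → u ∈ D → u ~ w → ListAll.All (u ≁_) us → ChordlessTo y (w ∷ us) →
             ChordlessTo y (u ∷ w ∷ us)

    -- The tail is searched first, so `w` is the last neighbour of `u` on the path. Cutting the path
    -- there leaves no chord at `u`.
    attach : ∀ u {y us} → ChordlessTo y us → ListAll.All (u ≁_) us ⊎
             (∃₂ λ w ws → u ~ w × ListAll.All (u ≁_) ws × ChordlessTo y (w ∷ ws))
    attach u {y} end with ~?≁ u y
    ... | inj₁ e = inj₂ (y , [] , e , [] , end)
    ... | inj₂ f = inj₁ (f ∷ [])
    attach u {us = v ∷ _} p@(cons _ _ _ q) with attach u q
    ... | inj₂ found = inj₂ found
    ... | inj₁ fs with ~?≁ u v
    ...   | inj₁ e = inj₂ (v , _ , e , fs , p)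
    ...   | inj₂ f = inj₁ (f ∷ fs)

    attach-nbr : ∀ {u w y us} → u ~ w → ChordlessTo y (w ∷ us) →
                 ∃₂ λ v vs → u ~ v × ListAll.All (u ≁_) vs × ChordlessTo y (v ∷ vs)
    attach-nbr {u} e p with attach u p
    ... | inj₁ (f ∷ _) = ⊥-elim (~⇒¬≁ e f)
    ... | inj₂ found   = found

    -- Vertices of the walk are prepended from its far end, each joined at its last neighbour on the
    -- path so far. Chordlessness is all that is used of a shortest path.
    walk⇒chordless : ∀ {u v y} → WalkIn G D u v → v ~ y → ∃ λ us → ChordlessTo y (u ∷ us)
    walk⇒chordless (here u∈D) e = _ , cons u∈D e [] end
    walk⇒chordless (step u∈D e walk) e′ with attach-nbr e (proj₂ (walk⇒chordless walk e′))
    ... | _ , _ , e″ , fs , p = _ , cons u∈D e″ fs p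

    -- `a` stands for a neighbour of `x` in another component than `D`; what the paths use of this
    -- is that `a` has no neighbour in `D`.
    record Attached (x a b : Fin n) : Set where
      constructor attached
      field
        x~a : x ~ a
        x~b : x ~ b
        b∈D : b ∈ D
        a≁D : ∀ {u} → u ∈ D → a ≁ u

    -- These are the non-edges that generic samples provide. Edges between `a` and `a′` or between
    -- `b` and `b′` stay undecided and lead to case distinctions.
    record Far (x a b x′ a′ b′ : Fin n) : Set where
      constructor far
      field
        x≁x′ : x ≁ x′
        a≁x′ : a ≁ x′
        b≁x′ : b ≁ x′
        a′≁x : a′ ≁ x
        b′≁x : b′ ≁ x

    far-sym : ∀ {x a b x′ a′ b′} → Far x a b x′ a′ b′ → Far x′ a′ b′ x a b
    far-sym (far p q r s t) = far (≁-sym p) s t q r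

    -- Induced six-vertex paths from attached vertices

    module _ (noP₆ : P6Free G) (connected : ∀ {u v} → u ∈ D → v ∈ D → WalkIn G D u v) where

      no-P₆ : (us : Vec (Fin n) 6) → Chordless us → ⊥
      no-P₆ us c = noP₆ (lookup us , chordless⇒P₆ us c)

      -- Otherwise a shortest path from x to x′ through D has at least two inner vertices,
      -- and together with a and a′ it contains an induced P₆.
      common-nbr : ∀ {x a b x′ a′ b′} → Attached x a b → Attached x′ a′ b′ → Far x a b x′ a′ b′ → a ≁ a′ →
                   ∃ λ d → d ∈ D × x ~ d × x′ ~ d
      common-nbr {x} {a} {x′ = y} {a′}
        (attached x~a x~b b∈D a≁D) (attached y~a′ y~b′ b′∈D a′≁D) (far x≁y a≁y _ a′≁x _) a≁a′
        with attach-nbr x~b (proj₂ (walk⇒chordless (connected b∈D b′∈D) (~-sym y~b′)))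
      -- Cases by the number of inner vertices of the path: none contradicts `x≁y`, one is a common
      -- neighbour, two take both pendants, three take `a` alone, and from four on `a`, `x` and the
      -- first four inner vertices suffice.
      ... | _ , _ , x~y , _ , end = ⊥-elim (~⇒¬≁ x~y x≁y)
      ... | d , _ , x~d , _ , cons d∈D d~y _ end = d , d∈D , x~d , ~-sym d~y
      ... | d₁ , _ , x~d₁ , x≁d₂ ∷ _ , cons d₁∈D d₁~d₂ (d₁≁y ∷ []) (cons {d₂} d₂∈D d₂~y [] end) =
        ⊥-elim (no-P₆ (a ∷ x ∷ d₁ ∷ d₂ ∷ y ∷ a′ ∷ [])
          ( ~-sym x~a , a≁D d₁∈D ∷ a≁D d₂∈D ∷ a≁y ∷ a≁a′ ∷ []
          , x~d₁ , x≁d₂ ∷ x≁y ∷ ≁-sym a′≁x ∷ []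
          , d₁~d₂ , d₁≁y ∷ ≁-sym (a′≁D d₁∈D) ∷ []
          , d₂~y , ≁-sym (a′≁D d₂∈D) ∷ []
          , y~a′ , [] , tt))
      ... | d₁ , _ , x~d₁ , x≁d₂ ∷ x≁d₃ ∷ _ ,
            cons d₁∈D d₁~d₂ (d₁≁d₃ ∷ d₁≁y ∷ []) (cons {d₂} d₂∈D d₂~d₃ (d₂≁y ∷ [])
              (cons {d₃} d₃∈D d₃~y [] end)) =
        ⊥-elim (no-P₆ (a ∷ x ∷ d₁ ∷ d₂ ∷ d₃ ∷ y ∷ [])
          ( ~-sym x~a , a≁D d₁∈D ∷ a≁D d₂∈D ∷ a≁D d₃∈D ∷ a≁y ∷ []
          , x~d₁ , x≁d₂ ∷ x≁d₃ ∷ x≁y ∷ []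
          , d₁~d₂ , d₁≁d₃ ∷ d₁≁y ∷ []
          , d₂~d₃ , d₂≁y ∷ []
          , d₃~y , [] , tt))
      ... | d₁ , _ , x~d₁ , x≁d₂ ∷ x≁d₃ ∷ x≁d₄ ∷ _ ,
            cons d₁∈D d₁~d₂ (d₁≁d₃ ∷ d₁≁d₄ ∷ _)
              (cons {d₂} d₂∈D d₂~d₃ (d₂≁d₄ ∷ _) (cons {d₃} d₃∈D d₃~d₄ _ (cons {d₄} d₄∈D _ _ _))) =
        ⊥-elim (no-P₆ (a ∷ x ∷ d₁ ∷ d₂ ∷ d₃ ∷ d₄ ∷ [])
          ( ~-sym x~a , a≁D d₁∈D ∷ a≁D d₂∈D ∷ a≁D d₃∈D ∷ a≁D d₄∈D ∷ []
          , x~d₁ , x≁d₂ ∷ x≁d₃ ∷ x≁d₄ ∷ []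
          , d₁~d₂ , d₁≁d₃ ∷ d₁≁d₄ ∷ []
          , d₂~d₃ , d₂≁d₄ ∷ []
          , d₃~d₄ , [] , tt))

      -- Whether `a₁` and `a₂` are adjacent is unknown, so each path takes only one of them. If `b`
      -- and `b₂` are adjacent, that edge prolongs the path v a₁ a u b; otherwise both serve as
      -- ends.
      two-adjacent : ∀ {u a b v a₁ b₁ w a₂ b₂} →
                     Attached u a b → Attached v a₁ b₁ → Attached w a₂ b₂ →
                     Far u a b v a₁ b₁ → Far u a b w a₂ b₂ → Far v a₁ b₁ w a₂ b₂ →
                     a ~ a₁ → a ~ a₂ → ⊥
      two-adjacent {u} {a} {b} {v} {a₁} {b₁} {w} {a₂} {b₂}
        (attached u~a u~b b∈D a≁D) (attached v~a₁ _ _ a₁≁D) (attached w~a₂ w~b₂ b₂∈D a₂≁D)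
        (far u≁v a≁v b≁v a₁≁u _) (far u≁w a≁w b≁w a₂≁u b₂≁u) (far _ _ _ _ b₂≁v) a~a₁ a~a₂
        with ~?≁ b b₂
      ... | inj₁ b~b₂ = no-P₆ (v ∷ a₁ ∷ a ∷ u ∷ b ∷ b₂ ∷ [])
          ( v~a₁ , ≁-sym a≁v ∷ ≁-sym u≁v ∷ ≁-sym b≁v ∷ ≁-sym b₂≁v ∷ []
          , ~-sym a~a₁ , a₁≁u ∷ a₁≁D b∈D ∷ a₁≁D b₂∈D ∷ []
          , ~-sym u~a , a≁D b∈D ∷ a≁D b₂∈D ∷ []
          , u~b , ≁-sym b₂≁u ∷ []
          , b~b₂ , [] , tt)
      ... | inj₂ b≁b₂ = no-P₆ (b ∷ u ∷ a ∷ a₂ ∷ w ∷ b₂ ∷ [])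
          ( ~-sym u~b , ≁-sym (a≁D b∈D) ∷ ≁-sym (a₂≁D b∈D) ∷ b≁w ∷ b≁b₂ ∷ []
          , u~a , ≁-sym a₂≁u ∷ u≁w ∷ ≁-sym b₂≁u ∷ []
          , a~a₂ , a≁w ∷ a≁D b₂∈D ∷ []
          , ~-sym w~a₂ , a₂≁D b₂∈D ∷ []
          , w~b₂ , [] , tt)

      -- The middle sample is `y`. Without an edge between `d` and `d′` the path x d y d′ z is
      -- induced and `a` extends it. With that edge x d d′ z takes over, with pendants `a` and `a₂`;
      -- if these are adjacent, they prolong a₁ y d x instead.
      two-nonadjacent : ∀ {x a b y a₁ b₁ z a₂ b₂ d d′} →
                        Attached x a b → Attached y a₁ b₁ → Attached z a₂ b₂ →
                        Far x a b y a₁ b₁ → Far x a b z a₂ b₂ → Far y a₁ b₁ z a₂ b₂ →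
                        a ≁ a₁ → a₁ ≁ a₂ →
                        d ∈ D → x ~ d → y ~ d → d ≁ z →
                        d′ ∈ D → y ~ d′ → z ~ d′ → d′ ≁ x → ⊥
      two-nonadjacent {x} {a} {b} {y} {a₁} {b₁} {z} {a₂} {b₂} {d} {d′}
        (attached x~a _ _ a≁D) (attached y~a₁ _ _ a₁≁D) (attached z~a₂ _ _ a₂≁D)
        (far x≁y a≁y _ a₁≁x _) (far x≁z a≁z _ a₂≁x _) (far y≁z _ _ a₂≁y _) a≁a₁ a₁≁a₂
        d∈D x~d y~d d≁z d′∈D y~d′ z~d′ d′≁x
        with ~?≁ d d′ | ~?≁ a a₂
      ... | inj₂ d≁d′ | _ = no-P₆ (a ∷ x ∷ d ∷ y ∷ d′ ∷ z ∷ [])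
          ( ~-sym x~a , a≁D d∈D ∷ a≁y ∷ a≁D d′∈D ∷ a≁z ∷ []
          , x~d , x≁y ∷ ≁-sym d′≁x ∷ x≁z ∷ []
          , ~-sym y~d , d≁d′ ∷ d≁z ∷ []
          , y~d′ , y≁z ∷ []
          , ~-sym z~d′ , [] , tt)
      ... | inj₁ d~d′ | inj₂ a≁a₂ = no-P₆ (a ∷ x ∷ d ∷ d′ ∷ z ∷ a₂ ∷ [])
          ( ~-sym x~a , a≁D d∈D ∷ a≁D d′∈D ∷ a≁z ∷ a≁a₂ ∷ []
          , x~d , ≁-sym d′≁x ∷ x≁z ∷ ≁-sym a₂≁x ∷ []
          , d~d′ , d≁z ∷ ≁-sym (a₂≁D d∈D) ∷ []
          , ~-sym z~d′ , ≁-sym (a₂≁D d′∈D) ∷ []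
          , z~a₂ , [] , tt)
      ... | inj₁ d~d′ | inj₁ a~a₂ = no-P₆ (a₁ ∷ y ∷ d ∷ x ∷ a ∷ a₂ ∷ [])
          ( ~-sym y~a₁ , a₁≁D d∈D ∷ a₁≁x ∷ ≁-sym a≁a₁ ∷ a₁≁a₂ ∷ []
          , y~d , ≁-sym x≁y ∷ ≁-sym a≁y ∷ ≁-sym a₂≁y ∷ []
          , ~-sym x~d , ≁-sym (a≁D d∈D) ∷ ≁-sym (a₂≁D d∈D) ∷ []
          , x~a , ≁-sym a₂≁x ∷ []
          , a~a₂ , [] , tt)

      module _ (a b : Fin n → Fin n) (d : Fin n → Fin n → Fin n) where

        Attached′ : Fin n → Set
        Attached′ x = Attached x (a x) (b x)

        Far′ : Fin n → Fin n → Set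
        Far′ x y = Far x (a x) (b x) y (a y) (b y)

        -- `d` is fixed for every pair beforehand, so that the third sample can be asked to avoid
        -- its neighbourhood; it has to be right only where a common neighbour in `D` exists.
        module _ (d-common : ∀ {x y} → (∃ λ w → w ∈ D × x ~ w × y ~ w) →
                              d x y ∈ D × x ~ d x y × y ~ d x y) where

          two-nonadjacent′ : ∀ {x y z} → Attached′ x → Attached′ y → Attached′ z → Far′ x y → Far′ y z → Far′ z x →
                             d x y ≁ z → d y z ≁ x → a x ≁ a y → a y ≁ a z → ⊥
          two-nonadjacent′ Ax Ay Az Fxy Fyz Fzx d≁z d≁x f g
            with d-common (common-nbr Ax Ay Fxy f) | d-common (common-nbr Ay Az Fyz g)
          ... | p , q , r | p′ , q′ , r′ =
            two-nonadjacent Ax Ay Az Fxy (far-sym Fzx) Fyz f g p q r d≁z p′ q′ r′ d≁x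

          -- Of the three pairs of outer neighbours two are adjacent or two are non-adjacent, and
          -- any two pairs share a sample, which becomes the centre. The cyclic order keeps `d` to
          -- the pairs (x, y), (y, z), (z, x).
          no-generic-triple : ∀ {x y z} → Attached′ x → Attached′ y → Attached′ z →
                              Far′ x y → Far′ y z → Far′ z x →
                              d x y ≁ z → d y z ≁ x → d z x ≁ y → ⊥
          no-generic-triple {x} {y} {z} Ax Ay Az Fxy Fyz Fzx fz fx fy
            with ~?≁ (a x) (a y) | ~?≁ (a y) (a z) | ~?≁ (a z) (a x)
          ... | inj₁ p | inj₁ q | _      = two-adjacent Ay Ax Az (far-sym Fxy) Fyz (far-sym Fzx) (~-sym p) q
          ... | inj₂ p | inj₂ q | _      = two-nonadjacent′ Ax Ay Az Fxy Fyz Fzx fz fx p q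
          ... | inj₁ p | inj₂ q | inj₁ r = two-adjacent Ax Ay Az Fxy (far-sym Fzx) Fyz p (~-sym r)
          ... | inj₁ p | inj₂ q | inj₂ r = two-nonadjacent′ Ay Az Ax Fyz Fzx Fxy fx fy q r
          ... | inj₂ p | inj₁ q | inj₁ r = two-adjacent Az Ay Ax (far-sym Fyz) Fzx (far-sym Fxy) (~-sym q) r
          ... | inj₂ p | inj₁ q | inj₂ r = two-nonadjacent′ Az Ax Ay Fzx Fxy Fyz fy fz r p

-- Components of G - X for a minimal nuke X

x∉p-x : ∀ {n} (p : Subset n) x → x ∉ p ∖ x
x∉p-x (_ ∷ p) (suc x) (there x∈) = x∉p-x p x x∈

∣p-x∣+1≡∣p∣ : ∀ {n} {p : Subset n} {x} → x ∈ p → suc ∣ p ∖ x ∣ ≡ ∣ p ∣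
∣p-x∣+1≡∣p∣ {p = _ ∷ p}       here       = cong (λ q → suc ∣ q ∣) (p─⊥≡p p)
∣p-x∣+1≡∣p∣ {p = inside ∷ _}  (there x∈) = cong suc (∣p-x∣+1≡∣p∣ x∈)
∣p-x∣+1≡∣p∣ {p = outside ∷ _} (there x∈) = ∣p-x∣+1≡∣p∣ x∈

ℕtoℚ-≤-trans : ∀ {q} k l → k ≤ l → ℕtoℚ l ≤ℚ q → ℕtoℚ k ≤ℚ q
ℕtoℚ-≤-trans k l k≤l = ℚ.≤-trans {ℕtoℚ k} {ℕtoℚ l} (ℕtoℚ-mono {k} {l} k≤l)

-- Walks and the component of a vertex

module _ {n : ℕ} {G : Graph n} where

  walk-source : ∀ {S u v} → WalkIn G S u v → u ∈ S
  walk-source (here u∈S)     = u∈S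
  walk-source (step u∈S _ _) = u∈S

  walk-mono : ∀ {S T u v} → S ⊆ T → WalkIn G S u v → WalkIn G T u v
  walk-mono S⊆T (here u∈S)       = here (S⊆T u∈S)
  walk-mono S⊆T (step u∈S e w)   = step (S⊆T u∈S) e (walk-mono S⊆T w)

  walk-trans : ∀ {S u v w} → WalkIn G S u v → WalkIn G S v w → WalkIn G S u w
  walk-trans (here _)         q = q
  walk-trans (step u∈S e p)   q = step u∈S e (walk-trans p q)

  walk-sym : ∀ {S u v} → WalkIn G S u v → WalkIn G S v u
  walk-sym (here u∈S) = here u∈S
  walk-sym (step {u} {w} u∈S e p) =
    walk-trans (walk-sym p) (step (walk-source p) (trans (sym G w u) e) (here u∈S))

  walk-preserves : ∀ {S T u v} → (∀ {a b} → a ∈ T → adj G a b ≡ true → b ∈ S → b ∈ T) →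
                   u ∈ T → WalkIn G S u v → v ∈ T
  walk-preserves closed u∈T (here _)     = u∈T
  walk-preserves closed u∈T (step _ e p) = walk-preserves closed (closed u∈T e (walk-source p)) p

-- Available at every vertex `v`, also in `X`, which makes taking the component a total function;
-- hence the condition in `avoids`.
record ComponentAt {n : ℕ} (G : Graph n) (X : Subset n) (v : Fin n) : Set where
  field
    set     : Subset n
    at      : v ∈ set
    reach   : ∀ {u} → u ∈ set → WalkIn G set v u
    avoids  : v ∉ X → ∀ {u} → u ∈ set → u ∉ X
    closed  : ∀ {u w} → u ∈ set → adj G u w ≡ true → w ∉ X → w ∈ set

  isComponent : v ∉ X → IsComponentOfMinus G X set
  isComponent v∉X = (v , at) , (λ _ → avoids v∉X)
    , (λ _ _ a b → walk-trans (walk-sym (reach a)) (reach b)) , λ _ _ → closed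

module _ {n : ℕ} (G : Graph n) (X : Subset n) (v : Fin n) where

  private
    -- Absorbs one neighbour outside `X` at a time. Strict growth inside a finite vertex set is
    -- well-founded, and when no such neighbour is left the set is closed.
    grow : ∀ S → Acc _⊃_ S → v ∈ S → (∀ {u} → u ∈ S → WalkIn G S v u) →
           (v ∉ X → ∀ {u} → u ∈ S → u ∉ X) → ComponentAt G X v
    grow S (acc rec) v∈S reach avoids
      with any? (λ u → any? λ w → (u ∈? S) ×-dec (adj G u w Bool.≟ true) ×-dec ¬? (w ∈? X) ×-dec ¬? (w ∈? S))
    ... | no ¬exit = record
      { set = S ; at = v∈S ; reach = reach ; avoids = avoids
      ; closed = λ {u} {w} u∈S e w∉X → in-S u w u∈S e w∉X }
      where
      in-S : ∀ u w → u ∈ S → adj G u w ≡ true → w ∉ X → w ∈ S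
      in-S u w u∈S e w∉X with w ∈? S
      ... | yes w∈S = w∈S
      ... | no w∉S  = ⊥-elim (¬exit (u , w , u∈S , e , w∉X , w∉S))
    ... | yes (u , w , u∈S , e , w∉X , w∉S) =
      grow T (rec (S⊆T , w , w∈T , w∉S)) (S⊆T v∈S) reach′ avoids′
      where
      T : Subset n
      T = S ∪ ⁅ w ⁆
      S⊆T : S ⊆ T
      S⊆T = p⊆p∪q ⁅ w ⁆
      w∈T : w ∈ T
      w∈T = q⊆p∪q S ⁅ w ⁆ (x∈⁅x⁆ w)
      reach′ : ∀ {t} → t ∈ T → WalkIn G T v t
      reach′ t∈T with x∈p∪q⁻ S ⁅ w ⁆ t∈T
      ... | inj₁ t∈S = walk-mono S⊆T (reach t∈S)
      ... | inj₂ t∈w rewrite x∈⁅y⁆⇒x≡y w t∈w =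
        walk-trans (walk-mono S⊆T (reach u∈S)) (step (S⊆T u∈S) e (here w∈T))
      avoids′ : v ∉ X → ∀ {t} → t ∈ T → t ∉ X
      avoids′ v∉X t∈T with x∈p∪q⁻ S ⁅ w ⁆ t∈T
      ... | inj₁ t∈S = avoids v∉X t∈S
      ... | inj₂ t∈w rewrite x∈⁅y⁆⇒x≡y w t∈w = w∉X

  abstract
    componentAt : ComponentAt G X v
    componentAt = grow ⁅ v ⁆ (⊃-wellFounded ⁅ v ⁆) (x∈⁅x⁆ v) reach avoids
      where
      reach : ∀ {u} → u ∈ ⁅ v ⁆ → WalkIn G ⁅ v ⁆ v u
      reach u∈ rewrite x∈⁅y⁆⇒x≡y v u∈ = here (x∈⁅x⁆ v)
      avoids : v ∉ X → ∀ {u} → u ∈ ⁅ v ⁆ → u ∉ X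
      avoids v∉X u∈ rewrite x∈⁅y⁆⇒x≡y v u∈ = v∉X

-- Returning a vertex of `X` to the graph

module _ {n : ℕ} (G : Graph n) (X : Subset n) where

  merged : (x : Fin n) → ComponentAt G (X ∖ x) x
  merged x = componentAt G (X ∖ x) x

  -- For x ∈ X this is the union of the components of G - X that x is adjacent to.
  reached : Fin n → Subset n
  reached x = ComponentAt.set (merged x) ∖ x

  part : Fin n → Subset n
  part v = ComponentAt.set (componentAt G X v)

  private
    ∈X-x : ∀ {x u} → u ∈ X → u ∉ X ∖ x → u ≡ x
    ∈X-x {x} {u} u∈X u∉ with u ≟ x
    ... | yes u≡x = u≡x
    ... | no u≢x  = ⊥-elim (u∉ (x∈p∧x≢y⇒x∈p-y u∈X u≢x))

    ∉X-x : ∀ {x u} → u ∉ X → u ∉ X ∖ x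
    ∉X-x {x} u∉X u∈ = u∉X (p─q⊆p X ⁅ x ⁆ u∈)

    ∈merged : ∀ {x u} → u ∈ reached x → u ∈ ComponentAt.set (merged x)
    ∈merged {x} = p─q⊆p _ ⁅ x ⁆

    merged-avoids : ∀ {x u} → u ∈ ComponentAt.set (merged x) → u ∉ X ∖ x
    merged-avoids {x} = ComponentAt.avoids (merged x) (x∉p-x X x)

  reached-avoids : ∀ {x u} → u ∈ reached x → u ∉ X
  reached-avoids {x} u∈S u∈X with refl ← ∈X-x u∈X (merged-avoids (∈merged u∈S)) = x∉p-x _ x u∈S

  -- Follow a walk from `v` back to `x` in the merged component. Before it meets `x` it avoids `X`,
  -- so it stays in the component of `v`; the vertex just before `x` is the neighbour.
  nbr-in-part : ∀ {x v} → x ∈ X → v ∈ reached x → ∃ λ b → adj G x b ≡ true × b ∈ part v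
  nbr-in-part {x} {v} x∈X v∈S = exit (ComponentAt.at D) (reached-avoids v∈S)
      (walk-sym (ComponentAt.reach (merged x) (∈merged v∈S)))
    where
    D : ComponentAt G X v
    D = componentAt G X v
    exit : ∀ {u} → u ∈ part v → u ∉ X → WalkIn G (ComponentAt.set (merged x)) u x →
           ∃ λ b → adj G x b ≡ true × b ∈ part v
    exit u∈D u∉X (here _) = ⊥-elim (u∉X x∈X)
    exit u∈D u∉X (step {u} {w} _ e p) with w ≟ x
    ... | yes refl = u , trans (sym G x u) e , u∈D
    ... | no w≢x   = exit (ComponentAt.closed D u∈D e w∉X) w∉X p
      where
      w∉X : w ∉ X
      w∉X w∈X = w≢x (∈X-x w∈X (merged-avoids (walk-source p)))

  -- Under the hypothesis no edge of the merged component leaves `part v` together with `x`, and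
  -- every vertex of that component is joined to `x` by a walk inside it.
  reached⊆part : ∀ {x v} → (∀ {a} → adj G x a ≡ true → a ∉ X → a ∈ part v) → reached x ⊆ part v
  reached⊆part {x} {v} nbrs {u} u∈S
    with x∈p∪q⁻ (part v) ⁅ x ⁆ (walk-preserves closed
           (q⊆p∪q (part v) ⁅ x ⁆ (x∈⁅x⁆ x)) (ComponentAt.reach (merged x) (∈merged u∈S)))
    where
    closed : ∀ {u w} → u ∈ part v ∪ ⁅ x ⁆ → adj G u w ≡ true → w ∈ ComponentAt.set (merged x) →
             w ∈ part v ∪ ⁅ x ⁆
    closed {u} {w} u∈ e w∈C with w ≟ x
    ... | yes refl = q⊆p∪q (part v) ⁅ x ⁆ (x∈⁅x⁆ x)
    ... | no w≢x with x∈p∪q⁻ (part v) ⁅ x ⁆ u∈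
    ...   | inj₁ u∈D = p⊆p∪q ⁅ x ⁆ (ComponentAt.closed (componentAt G X v) u∈D e
                         (λ w∈X → w≢x (∈X-x w∈X (merged-avoids w∈C))))
    ...   | inj₂ u∈x with refl ← x∈⁅y⁆⇒x≡y x u∈x =
      p⊆p∪q ⁅ x ⁆ (nbrs e (λ w∈X → w≢x (∈X-x w∈X (merged-avoids w∈C))))
  ... | inj₁ u∈D = u∈D
  ... | inj₂ u∈x with refl ← x∈⁅y⁆⇒x≡y x u∈x = ⊥-elim (x∉p-x _ x u∈S)

  component⊆merged : ∀ {x C} → IsComponentOfMinus G (X ∖ x) C → x ∈ C → C ⊆ ComponentAt.set (merged x)
  component⊆merged {x} (_ , avoids , walks , _) x∈C {u} u∈C = walk-preserves
    (λ a∈ e b∈C → ComponentAt.closed (merged x) a∈ e (avoids _ b∈C))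
    (ComponentAt.at (merged x)) (walks x u x∈C u∈C)

  component-off-x : ∀ {x C} → IsComponentOfMinus G (X ∖ x) C → x ∉ C → IsComponentOfMinus G X C
  component-off-x {C = C} (nonempty , avoids , walks , closed) x∉C =
      nonempty
    , (λ u u∈C u∈X → x∉C (subst (_∈ C) (∈X-x u∈X (avoids u u∈C)) u∈C))
    , walks
    , λ u w u∈C e w∉X → closed u w u∈C e (∉X-x w∉X)

  -- Returning `x` moves one vertex from `X` to the component.
  size-reached : ∀ {x} → x ∈ X → ∣ ComponentAt.set (merged x) ∣ ℕ.+ ∣ X ∖ x ∣ ≡ ∣ reached x ∣ ℕ.+ ∣ X ∣
  size-reached {x} x∈X = trans (cong (ℕ._+ ∣ X ∖ x ∣) (≡.sym (∣p-x∣+1≡∣p∣ (ComponentAt.at (merged x)))))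
    (trans (≡.sym (ℕ.+-suc ∣ reached x ∣ ∣ X ∖ x ∣)) (cong (∣ reached x ∣ ℕ.+_) (∣p-x∣+1≡∣p∣ x∈X)))

  module _ {η τ : ℚ} (nuke : IsNuke G η τ X) where

    component-bound : ∀ {C} → IsComponentOfMinus G X C → ℕtoℚ (∣ C ∣ ℕ.+ ∣ X ∣) ≤ℚ τ
    component-bound = let _ , _ , _ , _ , _ , _ , bound = nuke in bound _

    -- Only the merged component needs the hypothesis: any other component of G - (X - x) misses
    -- `x`, so it is a component of G - X and already bounded.
    removal-nuke : ∀ {x} → ℕtoℚ (∣ ComponentAt.set (merged x) ∣ ℕ.+ ∣ X ∖ x ∣) ≤ℚ τ →
                   IsNuke G η τ (X ∖ x)
    removal-nuke {x} merged-small =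
      let η>0 , η≤ , τ≥0 , τ≥ , τ≤ , ∣X∣≤ , _ = nuke in
      η>0 , η≤ , τ≥0 , τ≥ , τ≤ , ℕtoℚ-≤-trans (∣ X ∖ x ∣) (∣ X ∣) (p⊆q⇒∣p∣≤∣q∣ X-x⊆X) ∣X∣≤ ,
      λ C comp → bound C comp (x ∈? C)
      where
      X-x⊆X : X ∖ x ⊆ X
      X-x⊆X = p─q⊆p X ⁅ x ⁆
      bound : ∀ C → IsComponentOfMinus G (X ∖ x) C → Dec (x ∈ C) → ℕtoℚ (∣ C ∣ ℕ.+ ∣ X ∖ x ∣) ≤ℚ τ
      bound C comp (yes x∈C) = ℕtoℚ-≤-trans (∣ C ∣ ℕ.+ ∣ X ∖ x ∣)
        (∣ ComponentAt.set (merged x) ∣ ℕ.+ ∣ X ∖ x ∣)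
        (ℕ.+-monoˡ-≤ _ (p⊆q⇒∣p∣≤∣q∣ (component⊆merged comp x∈C))) merged-small
      bound C comp (no x∉C) = ℕtoℚ-≤-trans (∣ C ∣ ℕ.+ ∣ X ∖ x ∣) (∣ C ∣ ℕ.+ ∣ X ∣)
        (ℕ.+-monoʳ-≤ ∣ C ∣ (p⊆q⇒∣p∣≤∣q∣ X-x⊆X)) (component-bound (component-off-x comp x∉C))

    module _ (minimal : ∀ Y → Y ⊂ X → ¬ IsNuke G η τ Y) where

      -- By minimality X - x is not a nuke, and by `removal-nuke` the merged component must be too
      -- large.
      τ<reached : ∀ {x} → x ∈ X → τ < ℕtoℚ (∣ reached x ∣ ℕ.+ ∣ X ∣)
      τ<reached {x} x∈X = subst (λ k → τ < ℕtoℚ k) (size-reached x∈X)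
        (ℚ.≰⇒> (λ le → minimal (X ∖ x) (x∈p⇒p-x⊂p x∈X) (removal-nuke le)))

      -- Otherwise the reached set would lie inside the single component `part v`, whose size
      -- together with that of `X` is at most `τ`.
      nbr-off-part : ∀ {x v} → x ∈ X → v ∈ reached x →
                     ∃ λ a → adj G x a ≡ true × a ∉ X × a ∉ part v
      nbr-off-part {x} {v} x∈X v∈S =
        decidable-stable (any? (λ a → (adj G x a Bool.≟ true) ×-dec ¬? (a ∈? X) ×-dec ¬? (a ∈? part v)))
          λ ¬found → ℚ<⇒≱ (τ<reached x∈X) (ℕtoℚ-≤-trans (∣ reached x ∣ ℕ.+ ∣ X ∣)
            (∣ part v ∣ ℕ.+ ∣ X ∣) (ℕ.+-monoˡ-≤ ∣ X ∣ (p⊆q⇒∣p∣≤∣q∣ (reached⊆part λ e a∉X →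
              decidable-stable (_ ∈? part v) λ a∉D → ¬found (_ , e , a∉X , a∉D))))
            (component-bound (ComponentAt.isComponent (componentAt G X v) (reached-avoids v∈S))))

-- Generic triples of the nuke

module _ {n : ℕ} {P : Fin n → Set} (P? : ∀ w → Dec (P w)) where

  -- Made total by a default, so that conflict sets are defined for every pair of vertices.
  choose : Fin n → Fin n
  choose default with any? P?
  ... | yes (w , _) = w
  ... | no _        = default

  choose-spec : ∀ {default} → ∃ P → P (choose default)
  choose-spec ∃P with any? P?
  ... | yes (_ , p) = p
  ... | no ∄P       = ⊥-elim (∄P ∃P)

∉⋃N : ∀ {n} (G : Graph n) {z} us → z ∉ ⋃ (map (N G) us) → ListAll.All (λ u → adj G u z ≡ false) us
∉⋃N G []           _  = []
∉⋃N G {z} (u ∷ us) z∉ =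
  Bool.¬-not (λ e → z∉ (p⊆p∪q _ (lookup⇒[]= z (N G u) (trans (lookup∘tabulate (adj G u) z) e)))) ∷
  ∉⋃N G us (λ z∈ → z∉ (q⊆p∪q (N G u) _ z∈))

-- `s` counts the vertices outside `reached x`, `r` those in it, `k` is the size of `X` and `m` that
-- of the graph: s = m + k - (r + k), at most m + ηm - (1 - 2η)m = 3ηm.
missed-arithmetic : ∀ {η τ s r k m} → s + r ≡ m → τ < r + k → (1ℚ - ℕtoℚ 2 * η) * m ≤ℚ τ →
                    k ≤ℚ η * m → η ≤ℚ oneTenth → 0ℚ ≤ℚ m → s ≤ℚ m * (ℕtoℚ 3 * oneTenth)
missed-arithmetic {η} {τ} {s} {r} {k} {m} refl τ<r+k τ≥ k≤ η≤ m≥0 = begin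
  s                                                  ≡⟨ regroup s r k ⟩
  m + (k - (r + k))                                  ≤⟨ ℚ.+-monoʳ-≤ m (ℚ.+-mono-≤ k≤ -r-k≤) ⟩
  m + (η * m - (1ℚ - ℕtoℚ 2 * η) * m)                ≡⟨ collect η m ⟩
  m * (ℕtoℚ 3 * η)                                   ≤⟨ *-monoˡ-≤ m≥0 (*-monoˡ-≤ (ℚ.nonNegative⁻¹ (ℕtoℚ 3)) η≤) ⟩
  m * (ℕtoℚ 3 * oneTenth)                            ∎
  where
  open ℚ.≤-Reasoning
  open +-*-Solver
  -r-k≤ : ℚ.- (r + k) ≤ℚ ℚ.- ((1ℚ - ℕtoℚ 2 * η) * m)
  -r-k≤ = ℚ.neg-antimono-≤ (ℚ.≤-trans τ≥ (ℚ.<⇒≤ τ<r+k))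
  regroup : ∀ s r k → s ≡ (s + r) + (k - (r + k))
  regroup = solve 3 (λ s r k → s := (s :+ r) :+ (k :- (r :+ k))) refl
  collect : ∀ η m → m + (η * m - (1ℚ - ℕtoℚ 2 * η) * m) ≡ m * (ℕtoℚ 3 * η)
  collect = solve 2 (λ η m →
    m :+ (η :* m :- (con 1ℚ :- con (ℕtoℚ 2) :* η) :* m) := m :* (con (ℕtoℚ 3) :* η)) refl

-- Averaging over the vertices of the graph

module _ {n : ℕ} (G : Graph n) (X : Subset n) where

  -- Vertices outside `X` count as missing at no cost, since they have measure zero; so a sample may
  -- be any vertex of the graph.
  missing : Fin n → Subset n
  missing v = tabulate (λ x → not (lookup X x ∧ lookup (reached G X x) v))

  ∉missing : ∀ {x v} → x ∉ missing v → x ∈ X × v ∈ reached G X x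
  ∉missing {x} {v} x∉ with lookup X x in x∈ | lookup (reached G X x) v in v∈
  ... | true  | true  = lookup⇒[]= x X x∈ , lookup⇒[]= v (reached G X x) v∈
  ... | true  | false = ⊥-elim (x∉ (lookup⇒[]= x (missing v) (trans (lookup∘tabulate _ x)
                          (cong₂ (λ p q → not (p ∧ q)) x∈ v∈))))
  ... | false | _     = ⊥-elim (x∉ (lookup⇒[]= x (missing v) (trans (lookup∘tabulate _ x)
                          (cong (λ p → not (p ∧ lookup (reached G X x) v)) x∈))))

  missing+reached : ∀ {x} → x ∈ X → ∀ v → indicator (missing v) x + indicator (reached G X x) v ≡ 1ℚ
  missing+reached {x} x∈X v
    rewrite lookup∘tabulate (λ x → not (lookup X x ∧ lookup (reached G X x) v)) x | []=⇒lookup x∈X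
    with lookup (reached G X x) v
  ... | true  = refl
  ... | false = refl

  Σmissing+reached : ∀ {x} → x ∈ X → sumFin (λ v → indicator (missing v) x) + ℕtoℚ ∣ reached G X x ∣ ≡ ℕtoℚ n
  Σmissing+reached {x} x∈X = begin
    Σmissing + ℕtoℚ ∣ reached G X x ∣
      ≡⟨ cong (Σmissing +_) (∣∣≡sumFin-indicator (reached G X x)) ⟩
    Σmissing + sumFin (indicator (reached G X x))     ≡⟨ sumFin-+ (λ v → indicator (missing v) x) _ ⟨
    sumFin (λ v → indicator (missing v) x + indicator (reached G X x) v)
                                                      ≡⟨ sumFin-cong (missing+reached x∈X) ⟩
    sumFin {n} (λ _ → 1ℚ)                             ≡⟨ sumFin-const n 1ℚ ⟩
    ℕtoℚ n * 1ℚ                                       ≡⟨ ℚ.*-identityʳ (ℕtoℚ n) ⟩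
    ℕtoℚ n                                            ∎
    where
    open ≡.≡-Reasoning
    Σmissing : ℚ
    Σmissing = sumFin (λ v → indicator (missing v) x)

  module _ {μ : Fin n → ℚ} (prob : IsProbOn X μ) where

    private
      μ≥0 : ∀ u → 0ℚ ≤ℚ μ u
      μ≥0 = proj₁ prob

    on-X : ∀ u → (if lookup X u then μ u else 0ℚ) ≡ μ u
    on-X u with lookup X u in u∈
    ... | true  = refl
    ... | false = ≡.sym (proj₁ (proj₂ prob) u
                    (λ u∈X → contradiction (trans (≡.sym u∈) ([]=⇒lookup u∈X)) λ ()))

    total-mass : sumFin μ ≡ 1ℚ
    total-mass = trans (≡.sym (sumFin-cong on-X)) (proj₂ (proj₂ prob))

    measure-∩X : ∀ S → measure μ (S ∩ X) ≡ measure μ S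
    measure-∩X S = sumFin-cong pointwise
      where
      pointwise : ∀ u → (if lookup (S ∩ X) u then μ u else 0ℚ) ≡ (if lookup S u then μ u else 0ℚ)
      pointwise u rewrite lookup-zipWith _∧_ u S X with lookup S u
      ... | true  = on-X u
      ... | false = refl

    module _ {η τ : ℚ} (nuke : IsNuke G η τ X) (minimal : ∀ Y → Y ⊂ X → ¬ IsNuke G η τ Y) where

      missed-≤ : ∀ {x} → x ∈ X → sumFin (λ v → indicator (missing v) x) ≤ℚ ℕtoℚ n * (ℕtoℚ 3 * oneTenth)
      missed-≤ {x} x∈X =
        let _ , η≤ , _ , τ≥ , _ , ∣X∣≤ , _ = nuke in
        missed-arithmetic (Σmissing+reached x∈X)
          (subst (τ <_) (ℕtoℚ-+ ∣ reached G X x ∣ ∣ X ∣) (τ<reached G X nuke minimal x∈X))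
          τ≥ ∣X∣≤ η≤ (ℕtoℚ-mono {0} {n} z≤n)

      -- Double counting: the mean over `v` of the missing measure is the expected fraction of
      -- vertices that a sample `x` misses, at most 3/10.
      well-attached : 1 ≤ n → ∃ λ v → measure μ (missing v) ≤ℚ ℕtoℚ 3 * oneTenth
      well-attached 1≤n = average-≤ (ℕtoℚ 3 * oneTenth) (λ v → measure μ (missing v)) 1≤n (begin
        sumFin (λ v → measure μ (missing v))                   ≡⟨ sumFin-cong (λ v → measure≡𝔼 μ (missing v)) ⟩
        sumFin (λ v → 𝔼 μ (indicator (missing v)))             ≡⟨ sumFin-𝔼 μ (λ v → indicator (missing v)) ⟩
        𝔼 μ (λ x → sumFin (λ v → indicator (missing v) x))     ≤⟨ sumFin-mono (λ x → pointwise x (x ∈? X)) ⟩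
        𝔼 μ (λ _ → ℕtoℚ n * (ℕtoℚ 3 * oneTenth))               ≡⟨ 𝔼-const μ μ≥0 total-mass _ ⟩
        ℕtoℚ n * (ℕtoℚ 3 * oneTenth)                           ∎)
        where
        open ℚ.≤-Reasoning
        pointwise : ∀ x → Dec (x ∈ X) →
                    μ x * sumFin (λ v → indicator (missing v) x) ≤ℚ μ x * (ℕtoℚ n * (ℕtoℚ 3 * oneTenth))
        pointwise x (yes x∈X) = *-monoˡ-≤ (μ≥0 x) (missed-≤ x∈X)
        -- Outside `X` both sides vanish with `μ x`.
        pointwise x (no x∉X)  = ℚ.≤-reflexive (trans (null _) (≡.sym (null _)))
          where
          null : ∀ q → μ x * q ≡ 0ℚ
          null q = trans (cong (_* q) (proj₁ (proj₂ prob) x x∉X)) (ℚ.*-zeroˡ q)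

  -- Conflict sets of pairs of samples

  module _ (noP₆ : P6Free G) (v : Fin n)
           (nbr-off-D : ∀ {x} → x ∈ X → v ∈ reached G X x →
                        ∃ λ a → adj G x a ≡ true × a ∉ X × a ∉ part G X v) where

    private
      D : Subset n
      D = part G X v

      D-connected : ∀ {u w} → u ∈ D → w ∈ D → WalkIn G D u w
      D-connected u∈D w∈D = walk-trans (walk-sym (ComponentAt.reach (componentAt G X v) u∈D))
                                       (ComponentAt.reach (componentAt G X v) w∈D)

      outer? : ∀ x w → Dec (adj G x w ≡ true × w ∉ X × w ∉ D)
      outer? x w = (adj G x w Bool.≟ true) ×-dec ¬? (w ∈? X) ×-dec ¬? (w ∈? D)

      inner? : ∀ x w → Dec (adj G x w ≡ true × w ∈ D)
      inner? x w = (adj G x w Bool.≟ true) ×-dec (w ∈? D)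

      common? : ∀ x y w → Dec (w ∈ D × adj G x w ≡ true × adj G y w ≡ true)
      common? x y w = (w ∈? D) ×-dec (adj G x w Bool.≟ true) ×-dec (adj G y w Bool.≟ true)

    outer inner : Fin n → Fin n
    outer x = choose (outer? x) x
    inner x = choose (inner? x) x

    common : Fin n → Fin n → Fin n
    common x y = choose (common? x y) x

    attached-to-part : ∀ {x} → x ∉ missing v → Attached G D x (outer x) (inner x)
    attached-to-part {x} x∉
      with ∉missing x∉
    ... | x∈X , v∈
      with choose-spec (outer? x) {x} (nbr-off-D x∈X v∈)
         | choose-spec (inner? x) {x} (nbr-in-part G X x∈X v∈)
    ... | x~a , a∉X , a∉D | x~b , b∈D = attached x~a x~b b∈D λ u∈D →
      -- An edge from `D` to `a` would draw `a`, which is not in `X`, into `D`.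
      Bool.¬-not (λ e → a∉D (ComponentAt.closed (componentAt G X v) u∈D (~-sym G e) a∉X))

    private
      -- The third sample has to avoid the neighbourhoods of these; their number is the factor 7 in
      -- `conflict-≤`.
      sources : Fin n → Fin n → List (Fin n)
      sources x y = x ∷ y ∷ outer x ∷ outer y ∷ inner x ∷ inner y ∷ common x y ∷ []

    conflict : Fin n → Fin n → Subset n
    conflict x y = missing v ∪ ⋃ (map (N G) (sources x y))

    conflict-≤ : ∀ {μ p q} → (∀ u → 0ℚ ≤ℚ μ u) → measure μ (missing v) ≤ℚ p → (∀ u → measure μ (N G u) ≤ℚ q) →
                 ∀ x y → measure μ (conflict x y) ≤ℚ p + ℕtoℚ 7 * q
    conflict-≤ {μ} {p} {q} μ≥0 missing≤p N≤q x y = begin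
      measure μ (conflict x y)                                          ≤⟨ measure-∪ μ μ≥0 (missing v) _ ⟩
      measure μ (missing v) + measure μ (⋃ (map (N G) (sources x y)))
        ≤⟨ ℚ.+-mono-≤ missing≤p (measure-⋃ μ μ≥0 (N G) N≤q (sources x y)) ⟩
      p + ℕtoℚ 7 * q                                                    ∎
      where open ℚ.≤-Reasoning

    private
      ∉conflict : ∀ {x y z} → z ∉ conflict x y → z ∉ missing v × ListAll.All (λ u → adj G u z ≡ false) (sources x y)
      ∉conflict z∉ = (λ z∈ → z∉ (p⊆p∪q _ z∈)) , ∉⋃N G _ (λ z∈ → z∉ (q⊆p∪q (missing v) _ z∈))

    -- If all three memberships fail, each `Far` combines two of them: for `x` and `y`, that `y`
    -- avoids the choices for `z`, `x`, and that `x` avoids those for `y`, `z`.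
    conflicts-cover : ∀ x y z → z ∈ conflict x y ⊎ x ∈ conflict y z ⊎ y ∈ conflict z x
    conflicts-cover x y z with z ∈? conflict x y | x ∈? conflict y z | y ∈? conflict z x
    ... | yes z∈ | _      | _      = inj₁ z∈
    ... | no _   | yes x∈ | _      = inj₂ (inj₁ x∈)
    ... | no _   | no _   | yes y∈ = inj₂ (inj₂ y∈)
    ... | no z∉  | no x∉  | no y∉
      with ∉conflict z∉ | ∉conflict x∉ | ∉conflict y∉
    ... | z∉T , _ ∷ y≁z ∷ ax≁z ∷ ay≁z ∷ bx≁z ∷ by≁z ∷ dxy≁z ∷ []
        | x∉T , _ ∷ z≁x ∷ ay≁x ∷ az≁x ∷ by≁x ∷ bz≁x ∷ dyz≁x ∷ []
        | y∉T , _ ∷ x≁y ∷ az≁y ∷ ax≁y ∷ bz≁y ∷ bx≁y ∷ dzx≁y ∷ [] =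
      ⊥-elim (no-generic-triple G D noP₆ D-connected outer inner common (λ {x} {y} → choose-spec (common? x y))
        (attached-to-part x∉T) (attached-to-part y∉T) (attached-to-part z∉T)
        (far x≁y ax≁y bx≁y ay≁x by≁x) (far y≁z ay≁z by≁z az≁y bz≁y) (far z≁x az≁x bz≁x ax≁z bx≁z)
        dxy≁z dyz≁x dzx≁y)

-- Any value with 3 (3/10 + 7 γ₀) < 1 would do.
γ₀ : ℚ
γ₀ = ℤ.+ 1 ℚ./ 300

theorem11 : Σ ℚ λ γ → 0ℚ < γ ×
    (∀ (η : ℚ) → 0ℚ < η → η ≤ℚ oneTenth →
    ∀ (n : ℕ) (G : Graph n) → Connected G → P6Free G → 2 ≤ n →
    ∀ (τ : ℚ) → (1ℚ - ℕtoℚ 2 * η) * ℕtoℚ n ≤ℚ τ → τ ≤ℚ (1ℚ - η) * ℕtoℚ n →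
    ∀ (X : Subset n) → IsMinimalNuke G η τ X →
    ∀ (μ : Fin n → ℚ) → IsProbOn X μ →
    ∃ λ (v : Fin n) → γ ≤ℚ measure μ (N G v ∩ X))
theorem11 = γ₀ , ℚ.positive⁻¹ γ₀ ,
  λ η _ _ n G _ noP₆ 2≤n τ _ _ X (nuke , minimal) μ prob →
    -- The search is over a finite set, hence decidable, so every neighbourhood may be assumed to
    -- have measure below `γ₀`.
    decidable-stable (any? (λ v → γ₀ ℚ.≤? measure μ (N G v ∩ X))) λ none →
      let μ≥0 , _  = prob
          v , v-ok = well-attached G X prob nuke minimal (ℕ.<⇒≤ 2≤n)
          off : ∀ {x} → x ∈ X → v ∈ reached G X x → ∃ λ a → adj G x a ≡ true × a ∉ X × a ∉ part G X v
          off = nbr-off-part G X nuke minimal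
          N≤γ₀ : ∀ u → measure μ (N G u) ≤ℚ γ₀
          N≤γ₀ u = subst (_≤ℚ γ₀) (measure-∩X G X prob (N G u)) (ℚ.<⇒≤ (ℚ.≰⇒> (λ le → none (u , le))))
      -- Three times `c` is 3 (3/10 + 7/300) = 97/100, whereas the union bound would force at least
      -- 1.
      in ℚ<⇒≱ {c + (c + c)} {1ℚ} (toWitness {a? = c + (c + c) ℚ.<? 1ℚ} tt)
           (triple-bound μ μ≥0 (total-mass G X prob) {c} (conflict G X noP₆ v off)
             (conflict-≤ G X noP₆ v off μ≥0 v-ok N≤γ₀)
             (conflicts-cover G X noP₆ v off))
  where
  c : ℚ
  c = ℕtoℚ 3 * oneTenth + ℕtoℚ 7 * γ₀
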